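{- Let $L$ be a symmetric Latin square of order $n$ and let $\Gamma$ be its rrs-autotopism group. Then the number of isomorphism classes that contain a reduced symmetric Latin square rrs-isotopic to $L$ equals \[\frac{1}{|\Gamma|}\sum_{(\alpha,\alpha,\beta)\in\Gamma}\lambda(\alpha,\beta),\] where $\lambda(\alpha,\beta)$ is the number of fixed points of $\alpha$ if $\alpha$ and $\beta$ have the same cycle structure, and $\lambda(\alpha,\beta)=0$ otherwise.
   Context: A Latin square of order $n$ is a set of $n^2$ triples (row, column, symbol) over $\{1,\dots,n\}$, distinct triples agreeing in at most one coordinate; it is symmetric if it equals its transpose, and reduced if its first row and first column are $1,2,\dots,n$ in order. An isotopism $(\alpha,\beta,\gamma)\in\mathcal{S}_n^3$ maps $(r,c,s)$ to $(r^\alpha,c^\beta,s^\gamma)$; it is an rrs-isotopism if $\alpha=\beta$ and an isomorphism if $\alpha=\beta=\gamma$. The rrs-autotopism group of $L$ is the group of rrs-isotopisms mapping $L$ to itself. -}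

module Defs where

open import Data.Nat using (ℕ; zero; suc; _+_; _/_; _≤_)
open import Data.Nat.ListAction using (sum)
open import Data.Fin using (Fin; toℕ)
import Data.Fin as F
open import Data.Fin.Properties using (all?) renaming (_≟_ to _≟F_)
open import Data.List using (List; []; _∷_; map; concatMap; length; filter; allFin; cartesianProduct; upTo)
open import Data.List.Properties using (≡-dec)
open import Data.List.Relation.Unary.Any using (Any)
open import Data.List.Relation.Unary.All using (All)
open import Data.List.Relation.Unary.AllPairs using (AllPairs)
open import Data.Product using (Σ; ∃; ∃-syntax; _×_; _,_; proj₁; proj₂)
open import Data.Bool using (if_then_else_)
open import Relation.Nullary using (¬_; Dec; yes; no; does; _×-dec_; _→-dec_)
open import Relation.Binary.PropositionalEquality using (_≡_)
import Data.Nat as N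

-- Basic objects.  Symbols/rows/columns {1,…,n} are represented by Fin n,
-- with i ∈ {1,…,n} corresponding to the element of Fin n with toℕ = i-1.

-- A function Fin n → Fin n is a permutation iff it is injective (finite set).
IsPerm : ∀ {n} → (Fin n → Fin n) → Set
IsPerm {n} α = ∀ (i j : Fin n) → α i ≡ α j → i ≡ j

isPerm? : ∀ {n} (α : Fin n → Fin n) → Dec (IsPerm α)
isPerm? α = all? (λ i → all? (λ j → (α i ≟F α j) →-dec (i ≟F j)))

-- A square array: L r c = the symbol in cell (r,c).  The set of n² triples
-- {(r,c,L r c)} is a Latin square iff every row and every column is injective.
Square : ℕ → Set
Square n = Fin n → Fin n → Fin n

IsLatin : ∀ {n} → Square n → Set
IsLatin {n} L = (∀ (r c c' : Fin n) → L r c ≡ L r c' → c ≡ c')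
              × (∀ (c r r' : Fin n) → L r c ≡ L r' c → r ≡ r')

IsSymmetric : ∀ {n} → Square n → Set
IsSymmetric {n} L = ∀ (r c : Fin n) → L r c ≡ L c r

IsReduced : ∀ {n} → Square n → Set
IsReduced {n} L = ∀ (r c : Fin n) → (toℕ r ≡ 0 → L r c ≡ c) × (toℕ c ≡ 0 → L r c ≡ r)

-- The isotopism (α,β,γ) maps L onto M (i.e. {(rα,cβ,sγ) : (r,c,s) ∈ L} = M).
MapsTo : ∀ {n} → (Fin n → Fin n) → (Fin n → Fin n) → (Fin n → Fin n)
       → Square n → Square n → Set
MapsTo {n} α β γ L M = ∀ (r c : Fin n) → M (α r) (β c) ≡ γ (L r c)

mapsTo? : ∀ {n} α β γ (L M : Square n) → Dec (MapsTo α β γ L M)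
mapsTo? α β γ L M = all? (λ r → all? (λ c → M (α r) (β c) ≟F γ (L r c)))

RrsIsotopic : ∀ {n} → Square n → Square n → Set
RrsIsotopic {n} L M = Σ (Fin n → Fin n) λ α → Σ (Fin n → Fin n) λ γ →
  IsPerm α × IsPerm γ × MapsTo α α γ L M

Isomorphic : ∀ {n} → Square n → Square n → Set
Isomorphic {n} L M = Σ (Fin n → Fin n) λ θ → IsPerm θ × MapsTo θ θ θ L M

cons : ∀ {m n} → Fin n → (Fin m → Fin n) → Fin (suc m) → Fin n
cons x f F.zero = x
cons x f (F.suc i) = f i

allFuns : (m n : ℕ) → List (Fin m → Fin n)
allFuns zero n = (λ ()) ∷ []
allFuns (suc m) n = concatMap (λ f → map (λ x → cons x f) (allFin n)) (allFuns m n)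

rrsAutotopisms : ∀ {n} → Square n → List ((Fin n → Fin n) × (Fin n → Fin n))
rrsAutotopisms {n} L =
  filter (λ p → isPerm? (proj₁ p) ×-dec (isPerm? (proj₂ p) ×-dec mapsTo? (proj₁ p) (proj₁ p) (proj₂ p) L L))
         (cartesianProduct (allFuns n n) (allFuns n n))

iter : ∀ {n} → (Fin n → Fin n) → ℕ → Fin n → Fin n
iter α zero i = i
iter α (suc k) i = α (iter α k i)

-- least k ∈ {s, s+1, …, s+fuel-1} with α^k i = i (default 0)
periodSearch : ∀ {n} → (Fin n → Fin n) → Fin n → ℕ → ℕ → ℕ
periodSearch α i zero s = 0
periodSearch α i (suc fuel) s =
  if does (iter α s i ≟F i) then s else periodSearch α i fuel (suc s)

cycleLength : ∀ {n} → (Fin n → Fin n) → Fin n → ℕ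
cycleLength {n} α i = periodSearch α i n 1

-- number of cycles of α of length k+1
numCycles : ∀ {n} → (Fin n → Fin n) → ℕ → ℕ
numCycles {n} α k = length (filter (λ i → cycleLength α i N.≟ suc k) (allFin n)) / suc k

cycleStructure : ∀ {n} → (Fin n → Fin n) → List ℕ
cycleStructure {n} α = map (numCycles α) (upTo n)

fixedPoints : ∀ {n} → (Fin n → Fin n) → ℕ
fixedPoints {n} α = length (filter (λ i → α i ≟F i) (allFin n))

λ-fun : ∀ {n} → (Fin n → Fin n) → (Fin n → Fin n) → ℕ
λ-fun α β = if does (≡-dec N._≟_ (cycleStructure α) (cycleStructure β))
            then fixedPoints α else 0

-- "The number of isomorphism classes containing an element of S is k":
-- there is a list of k elements of S, pairwise non-isomorphic, such that
-- every element of S is isomorphic to one of them.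

IsClassRepresentatives : ∀ {n} → (Square n → Set) → List (Square n) → Set
IsClassRepresentatives {n} S reps =
    All S reps
  × AllPairs (λ A B → ¬ Isomorphic A B) reps
  × (∀ (M : Square n) → S M → Any (λ R → Isomorphic M R) reps)

ReducedSymIsotope : ∀ {n} → Square n → Square n → Set
ReducedSymIsotope L M = IsLatin M × IsSymmetric M × IsReduced M × RrsIsotopic L M

{-# OPTIONS --safe #-}

-- For every u the square M_u(r,c) = L_u⁻¹(L(r,c)), where L_u is row u of L, has
-- identity element u; up to isomorphism these are exactly the reduced symmetric
-- squares rrs-isotopic to L, and the isomorphisms M_u → M_v are exactly the α
-- with (α,α,β) ∈ Γ and α(u) = v.  Hence the isomorphism classes correspond to the
-- orbits of Γ on rows, and Burnside's lemma counts them.  If α fixes u then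
-- β = L_u α L_u⁻¹, so α and β have the same cycle structure and λ(α,β) is the
-- number of fixed points of α.
module Submission where

open import Defs
open import Data.Nat using (ℕ; zero; suc; _+_; _*_; _≤_; z≤n; s≤s)
import Data.Nat as N
open import Data.Nat.Properties using (≤-antisym; 1+n≰n)
open import Data.Nat.ListAction using (sum)
open import Data.Bool using (true; false; if_then_else_)
open import Data.Fin using (Fin; zero; suc; punchOut)
open import Data.Fin.Properties using (any?; injective⇒≤; punchOut-injective; toℕ-injective) renaming (_≟_ to _≟F_)
open import Data.Fin.Permutation.Components using (transpose; transpose-inverse)
open import Data.List using (List; []; _∷_; _++_; length; map; filter; concatMap; allFin; upTo; cartesianProduct; cartesianProductWith; deduplicate)
open import Data.List.Properties using (length-++; length-map; filter-++; length-removeAt′; map-∘; map-cong; map-cong-local; filter-none; ≡-dec)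
open import Data.List.Membership.Propositional using (find) renaming (_∈_ to _∈ₚ_)
open import Data.List.Membership.Propositional.Properties using (∈-allFin; ∈-filter⁺; ∈-filter⁻; ∈-cartesianProduct⁻)
import Data.List.Membership.Setoid.Properties as Membershipₚ
open import Data.List.Relation.Unary.Any using (Any; here; there; index; _─_)
import Data.List.Relation.Unary.Any as Any
import Data.List.Relation.Unary.Any.Properties as Anyₚ
open import Data.List.Relation.Unary.All using (All; []; _∷_)
import Data.List.Relation.Unary.All as All
import Data.List.Relation.Unary.All.Properties as Allₚ
open import Data.List.Relation.Unary.AllPairs using (AllPairs; []; _∷_)
import Data.List.Relation.Unary.AllPairs as AllPairs
import Data.List.Relation.Unary.AllPairs.Properties as AllPairsₚ
open import Data.List.Relation.Unary.Unique.Setoid using (Unique)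
import Data.List.Relation.Unary.Unique.Setoid.Properties as Uniqueₚ
open import Data.List.Relation.Unary.Unique.DecSetoid.Properties using (deduplicate-!)
open import Data.List.Relation.Unary.Unique.Propositional.Properties using (allFin⁺)
open import Data.Product using (Σ; ∃; _×_; _,_; proj₁; proj₂)
open import Data.Product.Relation.Binary.Pointwise.NonDependent using (_×ₛ_)
open import Function using (_∘_; id; mk⇔)
open import Level using (0ℓ)
open import Relation.Binary.Bundles using (Setoid; DecSetoid)
open import Relation.Binary.PropositionalEquality using (_≡_; _≢_; _≗_; refl; sym; trans; cong; cong₂; subst; setoid; _→-setoid_; module ≡-Reasoning)
open import Relation.Nullary using (¬_; Dec; yes; no; does; contradiction; _×-dec_)
open import Relation.Nullary.Decidable using (does-⇔; dec-true)
open import Relation.Unary using (Decidable)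

-- Counting in lists

module _ {A : Set} {P Q : A → Set} where

  Any-─⁺ : ∀ {xs} → (∀ {x} → P x → ¬ Q x) → (p : Any P xs) → Any Q xs → Any Q (xs ─ p)
  Any-─⁺ P#Q (here px) (here qx) = contradiction qx (P#Q px)
  Any-─⁺ P#Q (here px) (there q) = q
  Any-─⁺ P#Q (there p) (here qx) = here qx
  Any-─⁺ P#Q (there p) (there q) = there (Any-─⁺ P#Q p q)

module _ {A B : Set} {_#_ : A → A → Set} {R : A → B → Set}
         (R-injective : ∀ {x x′ y} → R x y → R x′ y → ¬ (x # x′)) where

  -- Pigeonhole: match the head of `xs` with some `y` and delete that `y` from `ys`. By injectivity
  -- no later element is related to it, so the later partners survive. A relation `R` and an
  -- apartness `_#_` replace a function and `≢` because the permutations counted below are compared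
  -- only pointwise.
  injection⇒length-≤ : ∀ {xs ys} → AllPairs _#_ xs → All (λ x → Any (R x) ys) xs →
                       length xs ≤ length ys
  injection⇒length-≤ [] [] = z≤n
  injection⇒length-≤ {ys = ys} (x#xs ∷ xs#) (y∈ys ∷ ys∈ys) =
    subst (suc _ ≤_) (sym (length-removeAt′ ys (index y∈ys)))
      (s≤s (injection⇒length-≤ xs# (All.zipWith
        (λ { (x#x′ , y′∈ys) → Any-─⁺ (λ Rxy Rx′y → R-injective Rxy Rx′y x#x′) y∈ys y′∈ys })
        (x#xs , ys∈ys))))

module _ {A B : Set} where

  length-cartesianProduct : (xs : List A) (ys : List B) →
                            length (cartesianProduct xs ys) ≡ length xs * length ys
  length-cartesianProduct []       ys = refl
  length-cartesianProduct (x ∷ xs) ys =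
    trans (length-++ (map (x ,_) ys))
          (cong₂ _+_ (length-map (x ,_) ys) (length-cartesianProduct xs ys))

  module _ {P : A × B → Set} (P? : Decidable P) where

    length-filter-map : ∀ x ys → length (filter P? (map (x ,_) ys))
                               ≡ length (filter (λ y → P? (x , y)) ys)
    length-filter-map x []       = refl
    length-filter-map x (y ∷ ys) with P? (x , y)
    ... | yes _ = cong suc (length-filter-map x ys)
    ... | no  _ = length-filter-map x ys

    length-filter-cartesianProduct : ∀ xs ys →
      length (filter P? (cartesianProduct xs ys))
        ≡ sum (map (λ x → length (filter (λ y → P? (x , y)) ys)) xs)
    length-filter-cartesianProduct []       ys = refl
    length-filter-cartesianProduct (x ∷ xs) ys = begin
      length (filter P? (map (x ,_) ys ++ cartesianProduct xs ys))
        ≡⟨ cong length (filter-++ P? (map (x ,_) ys) _) ⟩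
      length (filter P? (map (x ,_) ys) ++ filter P? (cartesianProduct xs ys))
        ≡⟨ length-++ (filter P? (map (x ,_) ys)) ⟩
      length (filter P? (map (x ,_) ys)) + length (filter P? (cartesianProduct xs ys))
        ≡⟨ cong₂ _+_ (length-filter-map x ys) (length-filter-cartesianProduct xs ys) ⟩
      length (filter (λ y → P? (x , y)) ys)
        + sum (map (λ x′ → length (filter (λ y → P? (x′ , y)) ys)) xs) ∎
      where open ≡-Reasoning

-- Meant for orbit representatives: it turns lying in the same orbit into equality of the
-- representatives.
Unique⇒≈⇒≡ : (S : Setoid 0ℓ 0ℓ) → let open Setoid S in
             ∀ {xs x y} → Unique S xs → x ∈ₚ xs → y ∈ₚ xs → x ≈ y → x ≡ y
Unique⇒≈⇒≡ S (x# ∷ xs!) (here refl) (here refl) x≈y = refl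
Unique⇒≈⇒≡ S (x# ∷ xs!) (here refl) (there y∈)  x≈y = contradiction x≈y (All.lookup x# y∈)
Unique⇒≈⇒≡ S (x# ∷ xs!) (there x∈)  (here refl) x≈y = contradiction (Setoid.sym S x≈y) (All.lookup x# x∈)
Unique⇒≈⇒≡ S (x# ∷ xs!) (there x∈)  (there y∈)  x≈y = Unique⇒≈⇒≡ S xs! x∈ y∈ x≈y

-- Permutations of Fin n

-- If `y` were missed, punching it out of the codomain would give an injection from `Fin (suc n)`
-- into `Fin n`.
IsPerm⇒surjective : ∀ {n} {α : Fin n → Fin n} → IsPerm α → ∀ y → ∃ λ x → α x ≡ y
IsPerm⇒surjective {suc n} {α} α-inj y with any? (λ x → α x ≟F y)
... | yes x,αx≡y = x,αx≡y
... | no y∉α = contradiction (injective⇒≤ {f = λ x → punchOut (y≢α x)}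
                   (λ {x} {x′} eq → α-inj x x′ (punchOut-injective (y≢α x) (y≢α x′) eq))) 1+n≰n
  where
  y≢α : ∀ x → y ≢ α x
  y≢α x eq = y∉α (x , sym eq)

module _ {n} {α : Fin n → Fin n} (α-perm : IsPerm α) where

  inv : Fin n → Fin n
  inv y = proj₁ (IsPerm⇒surjective α-perm y)

  inv-right : ∀ y → α (inv y) ≡ y
  inv-right y = proj₂ (IsPerm⇒surjective α-perm y)

  inv-left : ∀ x → inv (α x) ≡ x
  inv-left x = α-perm _ _ (inv-right (α x))

  inv-IsPerm : IsPerm inv
  inv-IsPerm i j eq = trans (sym (inv-right i)) (trans (cong α eq) (inv-right j))

∘-IsPerm : ∀ {n} {α β : Fin n → Fin n} → IsPerm α → IsPerm β → IsPerm (α ∘ β)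
∘-IsPerm α-perm β-perm i j eq = β-perm i j (α-perm _ _ eq)

transpose-IsPerm : ∀ {n} (i j : Fin n) → IsPerm (transpose i j)
transpose-IsPerm i j x y eq =
  trans (sym (transpose-inverse j i)) (trans (cong (transpose j i) eq) (transpose-inverse j i))

transpose-matchˡ : ∀ {n} (i j : Fin n) → transpose i j i ≡ j
transpose-matchˡ i j rewrite dec-true (i ≟F i) refl = refl

-- Conjugate permutations

module _ {n} {α β φ : Fin n → Fin n} (φ-perm : IsPerm φ) (βφ≗φα : β ∘ φ ≗ φ ∘ α) where

  iter-conj : ∀ k i → iter β k (φ i) ≡ φ (iter α k i)
  iter-conj zero    i = refl
  iter-conj (suc k) i = trans (cong β (iter-conj k i)) (βφ≗φα (iter α k i))

  periodSearch-conj : ∀ i fuel s → periodSearch β (φ i) fuel s ≡ periodSearch α i fuel s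
  periodSearch-conj i zero       s = refl
  periodSearch-conj i (suc fuel) s = cong₂ (λ b t → if b then s else t)
    -- By injectivity of `φ`, `β` brings `φ i` back after `s` steps exactly when `α` brings `i`
    -- back, so both searches take the same branch.
    (does-⇔ (mk⇔ (λ eq → φ-perm _ _ (trans (sym (iter-conj s i)) eq))
                 (λ eq → trans (iter-conj s i) (cong φ eq)))
            (iter β s (φ i) ≟F φ i) (iter α s i ≟F i))
    (periodSearch-conj i fuel (suc s))

  cycleLength-conj : ∀ i → cycleLength β (φ i) ≡ cycleLength α i
  cycleLength-conj i = periodSearch-conj i n 1

  -- `φ` carries the points on cycles of `α` of length `suc k` bijectively to those of `β`. The
  -- first inequality counts along `φ`, the second along its inverse; equal numerators give equal
  -- quotients.
  numCycles-conj : ∀ k → numCycles α k ≡ numCycles β k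
  numCycles-conj k = cong (N._/ suc k) (≤-antisym
    (injection⇒length-≤ {R = λ i j → φ i ≡ j} (λ { refl eq i≢j → i≢j (sym (φ-perm _ _ eq)) })
      (Uniqueₚ.filter⁺ (setoid _) α? (allFin⁺ n))
      (All.tabulate λ {i} i∈ →
        ∈-filter⁺ β? (∈-allFin (φ i))
          (trans (cycleLength-conj i) (proj₂ (∈-filter⁻ α? {xs = allFin n} i∈)))))
    (injection⇒length-≤ {R = λ j i → φ i ≡ j} (λ { refl refl i≢j → i≢j refl })
      (Uniqueₚ.filter⁺ (setoid _) β? (allFin⁺ n))
      (All.tabulate λ {j} j∈ →
        Any.map (λ { refl → inv-right φ-perm j })
          (∈-filter⁺ α? (∈-allFin (inv φ-perm j))
            (trans (sym (cycleLength-conj _))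
              (trans (cong (cycleLength β) (inv-right φ-perm j))
                     (proj₂ (∈-filter⁻ β? {xs = allFin n} j∈))))))))
    where
    α? : Decidable (λ i → cycleLength α i ≡ suc k)
    α? i = cycleLength α i N.≟ suc k
    β? : Decidable (λ i → cycleLength β i ≡ suc k)
    β? i = cycleLength β i N.≟ suc k

  cycleStructure-conj : cycleStructure α ≡ cycleStructure β
  cycleStructure-conj = map-cong numCycles-conj (upTo n)

-- Burnside's lemma

infix 4 _∈_

-- Membership up to pointwise equality: an enumeration meets a composite or an inverse only in this
-- sense.
_∈_ : ∀ {n} → (Fin n → Fin n) → List (Fin n → Fin n) → Set
f ∈ G = Any (f ≗_) G

module Burnside {n : ℕ} (G : List (Fin n → Fin n))
  (G! : Unique (Fin n →-setoid Fin n) G)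
  (id∈G : id ∈ G)
  (∘∈G : ∀ {f g} → f ∈ G → g ∈ G → (f ∘ g) ∈ G)
  (inverse : ∀ {f} → f ∈ G → ∃ λ g → g ∈ G × g ∘ f ≗ id × f ∘ g ≗ id) where

  private
    F : Setoid 0ℓ 0ℓ
    F = Fin n →-setoid Fin n

    ∈ₚ⇒∈ : ∀ {f} → f ∈ₚ G → f ∈ G
    ∈ₚ⇒∈ = Any.map λ { refl _ → refl }

  infix 4 _~_

  -- The orbit relation, phrased as a search through `G` so that it is decidable and `deduplicate`
  -- can pick representatives.
  _~_ : Fin n → Fin n → Set
  u ~ v = Any (λ g → g u ≡ v) G

  ~-intro : ∀ {f u v} → f ∈ G → f u ≡ v → u ~ v
  ~-intro {u = u} f∈G fu≡v = Any.map (λ f≗g → trans (sym (f≗g u)) fu≡v) f∈G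

  ~-elim : ∀ {u v} → u ~ v → ∃ λ g → g ∈ G × g u ≡ v
  ~-elim u~v with g , g∈G , gu≡v ← find u~v = g , ∈ₚ⇒∈ g∈G , gu≡v

  ~-refl : ∀ {u} → u ~ u
  ~-refl = ~-intro id∈G refl

  ~-sym : ∀ {u v} → u ~ v → v ~ u
  ~-sym u~v with g , g∈G , refl ← ~-elim u~v
            with k , k∈G , kg , _ ← inverse g∈G = ~-intro k∈G (kg _)

  ~-trans : ∀ {u v w} → u ~ v → v ~ w → u ~ w
  ~-trans u~v v~w with g , g∈G , refl ← ~-elim u~v
                  with h , h∈G , refl ← ~-elim v~w = ~-intro (∘∈G h∈G g∈G) refl

  _~?_ : ∀ u v → Dec (u ~ v)
  u ~? v = Any.any? (λ g → g u ≟F v) G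

  orbitDecSetoid : DecSetoid 0ℓ 0ℓ
  orbitDecSetoid = record
    { Carrier = Fin n
    ; _≈_ = _~_
    ; isDecEquivalence = record
      { isEquivalence = record { refl = ~-refl ; sym = ~-sym ; trans = ~-trans }
      ; _≟_ = _~?_
      }
    }

  private
    O : Setoid 0ℓ 0ℓ
    O = DecSetoid.setoid orbitDecSetoid

  orbitReps : List (Fin n)
  orbitReps = deduplicate _~?_ (allFin n)

  orbitReps-! : Unique O orbitReps
  orbitReps-! = deduplicate-! orbitDecSetoid (allFin n)

  orbitReps-complete : ∀ u → Any (u ~_) orbitReps
  orbitReps-complete u =
    Membershipₚ.∈-deduplicate⁺ O _~?_ (λ z~y x~y → ~-trans x~y (~-sym z~y))
      (Any.map (λ { refl → ~-refl }) (∈-allFin u))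

  private
    -- A transversal. The transporter depends on `x` alone, so pairs with the same point `x` are
    -- compared through the same `h x`.
    root : ∀ x → ∃ λ r → r ∈ₚ orbitReps × (∃ λ h → h ∈ G × h r ≡ x)
    root x with r , r∈ , x~r ← find (orbitReps-complete x) = r , r∈ , ~-elim (~-sym x~r)

    h : Fin n → Fin n → Fin n
    h x = proj₁ (proj₂ (proj₂ (root x)))

    h∈G : ∀ x → h x ∈ G
    h∈G x = proj₁ (proj₂ (proj₂ (proj₂ (root x))))

    h-root : ∀ x → h x (proj₁ (root x)) ≡ x
    h-root x = proj₂ (proj₂ (proj₂ (proj₂ (root x))))

    Fixes : (Fin n → Fin n) × Fin n → Set
    Fixes (s , x) = s x ≡ x

    fixes? : Decidable Fixes
    fixes? (s , x) = s x ≟F x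

    fixedPairs : List ((Fin n → Fin n) × Fin n)
    fixedPairs = filter fixes? (cartesianProduct G (allFin n))

    -- The bijection (r , g) ↦ (g h⁻¹ , x) with x = g r, where h = h x moves the
    -- representative of the orbit of x to x.
    Corresponds : Fin n × (Fin n → Fin n) → (Fin n → Fin n) × Fin n → Set
    Corresponds (r , g) (s , x) = g ∈ G × g r ≡ x × g ≗ s ∘ h x

    -- Injective because `g = s h` is recovered from `(s , x)`, and `r` lies in the orbit of `x`;
    -- agreement up to `~` suffices, as representatives are distinct up to `~`.
    pairs≤ : length (cartesianProduct orbitReps G) ≤ length fixedPairs
    pairs≤ = injection⇒length-≤ {R = Corresponds} (λ {p} {p′} {q} → injective {p} {p′} {q})
      (Uniqueₚ.cartesianProduct⁺ O F orbitReps-! G!) (All.tabulate λ {p} → total p)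
      where
      injective : ∀ {p p′ q} → Corresponds p q → Corresponds p′ q →
                  ¬ ¬ (proj₁ p ~ proj₁ p′ × proj₂ p ≗ proj₂ p′)
      injective (g∈G , refl , g≗sh) (g′∈G , g′r′≡x , g′≗sh) p≢p′ =
        p≢p′ (~-trans (~-intro g∈G refl) (~-sym (~-intro g′∈G g′r′≡x)) ,
              λ i → trans (g≗sh i) (sym (g′≗sh i)))
      total : ∀ p → p ∈ₚ cartesianProduct orbitReps G → Any (Corresponds p) fixedPairs
      total (r , g) p∈ with r∈ , g∈ ← ∈-cartesianProduct⁻ orbitReps G p∈
                       with k , k∈G , kh , hk ← inverse (h∈G (g r)) =
        Any.map (λ { (gk≗s , refl) → ∈ₚ⇒∈ g∈ , refl , λ i → trans (cong g (sym (kh i))) (gk≗s (h (g r) i)) })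
          (Membershipₚ.∈-filter⁺ (F ×ₛ setoid (Fin n)) fixes?
            (λ { (s≗t , refl) sx≡x → trans (sym (s≗t _)) sx≡x })
            (Membershipₚ.∈-cartesianProduct⁺ F (setoid (Fin n))
              (∘∈G (∈ₚ⇒∈ g∈) k∈G) (∈-allFin (g r)))
            -- `g ∘ k` fixes `x = g r`: the inverse `k` of `h x` takes `x` back to its
            -- representative, which is `r`, and `g` takes `r` to `x` again.
            (cong g (trans (cong k (sym (h-root (g r)))) (trans (kh _) root≡r))))
        where
        root≡r : proj₁ (root (g r)) ≡ r
        root≡r = Unique⇒≈⇒≡ O orbitReps-! (proj₁ (proj₂ (root (g r)))) r∈
          (~-trans (~-intro (h∈G (g r)) (h-root (g r))) (~-sym (~-intro (∈ₚ⇒∈ g∈) refl)))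

    -- The pair `(s , x)` comes from the representative of `x` and `g = s h`: here `g` sends the
    -- representative to `s x = x`. Given `(r , g)`, `x` is `g r`, and `s` is recovered by
    -- cancelling `h x` on the right.
    pairs≥ : length fixedPairs ≤ length (cartesianProduct orbitReps G)
    pairs≥ = injection⇒length-≤ {R = λ q p → Corresponds p q} (λ {q} {q′} {p} → injective {q} {q′} {p})
      (Uniqueₚ.filter⁺ (F ×ₛ setoid (Fin n)) fixes?
        (Uniqueₚ.cartesianProduct⁺ F (setoid (Fin n)) G! (allFin⁺ n)))
      (All.tabulate λ {q} → total q)
      where
      injective : ∀ {q q′ p} → Corresponds p q → Corresponds p q′ →
                  ¬ ¬ (proj₁ q ≗ proj₁ q′ × proj₂ q ≡ proj₂ q′)
      injective {s , x} {s′ , _} (_ , refl , g≗sh) (_ , refl , g≗s′h) q≢q′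
        with k , _ , _ , hk ← inverse (h∈G x) =
        q≢q′ ((λ i → trans (cong s (sym (hk i)))
                    (trans (sym (g≗sh (k i))) (trans (g≗s′h (k i)) (cong s′ (hk i))))) , refl)
      total : ∀ q → q ∈ₚ fixedPairs → Any (λ p → Corresponds p q) (cartesianProduct orbitReps G)
      total (s , x) q∈ with q∈′ , sx≡x ← ∈-filter⁻ fixes? {xs = cartesianProduct G (allFin n)} q∈
                       with s∈ , _ ← ∈-cartesianProduct⁻ G (allFin n) q∈′ =
        Any.map (λ { (refl , sh≗g) →
            Membershipₚ.∈-resp-≈ F sh≗g (∘∈G (∈ₚ⇒∈ s∈) (h∈G x)) ,
            trans (sym (sh≗g _)) (trans (cong s (h-root x)) sx≡x) ,
            sym ∘ sh≗g })
          (Membershipₚ.∈-cartesianProduct⁺ (setoid (Fin n)) F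
            (proj₁ (proj₂ (root x))) (∘∈G (∈ₚ⇒∈ s∈) (h∈G x)))

  -- Counted by second coordinate, the fixed pairs `(s , x)` become a sum over `s`; counted through
  -- the correspondence, they are the pairs of a representative and a group element.
  burnside : length orbitReps * length G ≡ sum (map fixedPoints G)
  burnside = begin
    length orbitReps * length G              ≡⟨ length-cartesianProduct orbitReps G ⟨
    length (cartesianProduct orbitReps G)    ≡⟨ ≤-antisym pairs≤ pairs≥ ⟩
    length fixedPairs                        ≡⟨ length-filter-cartesianProduct fixes? G (allFin n) ⟩
    sum (map fixedPoints G)                  ∎
    where open ≡-Reasoning

-- Enumeration of the rrs-autotopism group

concatMap-map : ∀ {A B C : Set} (f : A → B → C) xs ys →
                concatMap (λ x → map (f x) ys) xs ≡ cartesianProductWith f xs ys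
concatMap-map f []       ys = refl
concatMap-map f (x ∷ xs) ys = cong (map (f x) ys ++_) (concatMap-map f xs ys)

-- Exposes the enumeration as a product, so that completeness and absence of repetitions follow by
-- induction from those of the factors.
allFuns-suc : ∀ m n → allFuns (suc m) n
                    ≡ cartesianProductWith (λ f x → cons x f) (allFuns m n) (allFin n)
allFuns-suc m n = concatMap-map (λ f x → cons x f) (allFuns m n) (allFin n)

cons-cong : ∀ {m n} {f g : Fin m → Fin n} {x y} → f ≗ g → x ≡ y → cons x f ≗ cons y g
cons-cong f≗g x≡y zero    = x≡y
cons-cong f≗g x≡y (suc i) = f≗g i

cons-uncons : ∀ {m n} (f : Fin (suc m) → Fin n) → f ≗ cons (f zero) (f ∘ suc)
cons-uncons f zero    = refl
cons-uncons f (suc i) = refl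

allFuns-complete : ∀ m n (f : Fin m → Fin n) → Any (f ≗_) (allFuns m n)
allFuns-complete zero    n f = here λ ()
allFuns-complete (suc m) n f = subst (Any (f ≗_)) (sym (allFuns-suc m n))
  (Anyₚ.cartesianProductWith⁺ _
    (λ fs≗g fz≡x i → trans (cons-uncons f i) (cons-cong fs≗g fz≡x i))
    (allFuns-complete m n (f ∘ suc)) (∈-allFin (f zero)))

allFuns-! : ∀ m n → Unique (Fin m →-setoid Fin n) (allFuns m n)
allFuns-! zero    n = [] ∷ []
allFuns-! (suc m) n = subst (Unique (Fin (suc m) →-setoid Fin n)) (sym (allFuns-suc m n))
  (Uniqueₚ.cartesianProductWith⁺ (Fin m →-setoid Fin n) (setoid (Fin n)) (Fin (suc m) →-setoid Fin n)
    (λ f x → cons x f) (λ eq → eq ∘ suc , eq zero) (allFuns-! m n) (allFin⁺ n))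

IsRrsIsotopism : ∀ {n} → Square n → Square n → (Fin n → Fin n) × (Fin n → Fin n) → Set
IsRrsIsotopism L M (α , γ) = IsPerm α × IsPerm γ × MapsTo α α γ L M

IsPerm-resp-≗ : ∀ {n} {α α′ : Fin n → Fin n} → α ≗ α′ → IsPerm α → IsPerm α′
IsPerm-resp-≗ α≗α′ α-perm i j eq = α-perm i j (trans (α≗α′ i) (trans eq (sym (α≗α′ j))))

module _ {n} (L : Square n) where

  private
    F : Setoid 0ℓ 0ℓ
    F = Fin n →-setoid Fin n

    isAutotopism? : Decidable (IsRrsIsotopism L L)
    isAutotopism? p = isPerm? (proj₁ p) ×-dec (isPerm? (proj₂ p) ×-dec mapsTo? (proj₁ p) (proj₁ p) (proj₂ p) L L)

  IsRrsAutotopism-resp-≗ : ∀ {α α′ β β′} → α ≗ α′ × β ≗ β′ →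
    IsRrsIsotopism L L (α , β) → IsRrsIsotopism L L (α′ , β′)
  IsRrsAutotopism-resp-≗ (α≗α′ , β≗β′) (α-perm , β-perm , maps) =
    IsPerm-resp-≗ α≗α′ α-perm , IsPerm-resp-≗ β≗β′ β-perm ,
    λ r c → trans (cong₂ L (sym (α≗α′ r)) (sym (α≗α′ c))) (trans (maps r c) (β≗β′ (L r c)))

  rrsAutotopisms-sound : All (IsRrsIsotopism L L) (rrsAutotopisms L)
  rrsAutotopisms-sound = Allₚ.all-filter isAutotopism? (cartesianProduct (allFuns n n) (allFuns n n))

  rrsAutotopisms-complete : ∀ {α β} → IsRrsIsotopism L L (α , β) →
    Any (λ p → α ≗ proj₁ p × β ≗ proj₂ p) (rrsAutotopisms L)
  rrsAutotopisms-complete {α} {β} aut =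
    Membershipₚ.∈-filter⁺ (F ×ₛ F) isAutotopism? IsRrsAutotopism-resp-≗
      (Membershipₚ.∈-cartesianProduct⁺ F F (allFuns-complete n n α) (allFuns-complete n n β)) aut

  rrsAutotopisms-! : Unique (F ×ₛ F) (rrsAutotopisms L)
  rrsAutotopisms-! = Uniqueₚ.filter⁺ (F ×ₛ F) isAutotopism?
    (Uniqueₚ.cartesianProduct⁺ F F (allFuns-! n n) (allFuns-! n n))

-- The restriction to `P` matters: distinct pairs are sure to have distinct row permutations only
-- when both are autotopisms.
AllPairs-map-local : ∀ {A : Set} {P : A → Set} {R S : A → A → Set} →
  (∀ {x y} → P x → P y → R x y → S x y) → ∀ {xs} → All P xs → AllPairs R xs → AllPairs S xs
AllPairs-map-local f []         []         = []
AllPairs-map-local f (px ∷ pxs) (rx ∷ rxs) =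
  All.zipWith (λ { (py , rxy) → f px py rxy }) (pxs , rx) ∷ AllPairs-map-local f pxs rxs

-- If `u` is fixed, row `u` of `L` is the conjugating permutation, since
-- `β (L u c) = L (α u) (α c) = L u (α c)`. If nothing is fixed, both branches of the conditional
-- are 0.
λ-fun≡fixedPoints : ∀ {n} {L : Square n} → IsLatin L → ∀ {α β} →
  IsRrsIsotopism L L (α , β) → λ-fun α β ≡ fixedPoints α
λ-fun≡fixedPoints {n} {L} latin {α} {β} (_ , _ , maps) with any? (λ u → α u ≟F u)
... | yes (u , αu≡u)
  rewrite dec-true (≡-dec N._≟_ (cycleStructure α) (cycleStructure β))
            (cycleStructure-conj {α = α} {β} (proj₁ latin u)
              (λ c → trans (sym (maps u c)) (cong (λ v → L v (α c)) αu≡u))) = refl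
... | no ¬fixed
  rewrite filter-none (λ i → α i ≟F i) {xs = allFin n} (All.tabulate λ {u} _ αu≡u → ¬fixed (u , αu≡u))
  with does (≡-dec N._≟_ (cycleStructure α) (cycleStructure β))
... | true  = refl
... | false = refl

-- Reduced isotopes

-- M is reduced, and its identity is the image of row u of L.
record UnitalIsotope {m} (L : Square (suc m)) (u : Fin (suc m)) (M : Square (suc m)) : Set where
  field
    α γ     : Fin (suc m) → Fin (suc m)
    α-perm  : IsPerm α
    γ-perm  : IsPerm γ
    maps    : MapsTo α α γ L M
    reduced : IsReduced M
    αu≡0    : α u ≡ zero

  -- The first row of `M` is the identity and comes from row `u`, so the symbol permutation is
  -- forced: `γ` is `α` after the inverse of `L u`.
  γ∘Lu≗α : γ ∘ L u ≗ α
  γ∘Lu≗α d = begin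
    γ (L u d)      ≡⟨ maps u d ⟨
    M (α u) (α d)  ≡⟨ cong (λ v → M v (α d)) αu≡0 ⟩
    M zero (α d)   ≡⟨ proj₁ (reduced zero (α d)) refl ⟩
    α d            ∎
    where open ≡-Reasoning

isotope : ∀ {n} {α : Fin n → Fin n} → IsPerm α → (Fin n → Fin n) → Square n → Square n
isotope α-perm γ L r c = γ (L (inv α-perm r) (inv α-perm c))

module _ {n} {L : Square n} {α γ : Fin n → Fin n} (α-perm : IsPerm α) (γ-perm : IsPerm γ) where

  isotope-IsRrsIsotopism : IsRrsIsotopism L (isotope α-perm γ L) (α , γ)
  isotope-IsRrsIsotopism = α-perm , γ-perm ,
    λ r c → cong γ (cong₂ L (inv-left α-perm r) (inv-left α-perm c))

  isotope-IsLatin : IsLatin L → IsLatin (isotope α-perm γ L)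
  isotope-IsLatin (rows , cols) =
    (λ r c c′ eq → inv-IsPerm α-perm c c′ (rows _ _ _ (γ-perm _ _ eq))) ,
    (λ c r r′ eq → inv-IsPerm α-perm r r′ (cols _ _ _ (γ-perm _ _ eq)))

  isotope-IsSymmetric : IsSymmetric L → IsSymmetric (isotope α-perm γ L)
  isotope-IsSymmetric symmetric r c = cong γ (symmetric _ _)

module _ {m} {L : Square (suc m)} (latin : IsLatin L) where

  module _ (u : Fin (suc m)) where

    private
      σ-perm : IsPerm (transpose u zero)
      σ-perm = transpose-IsPerm u zero

      -- The only choice compatible with `γ∘Lu≗α` once the row permutation is the transposition of
      -- `u` and `zero`.
      γ : Fin (suc m) → Fin (suc m)
      γ = transpose u zero ∘ inv (proj₁ latin u)

      γ-perm : IsPerm γ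
      γ-perm = ∘-IsPerm σ-perm (inv-IsPerm (proj₁ latin u))

    -- M_u with its identity u moved to the first place.
    reducedAt : Square (suc m)
    reducedAt = isotope σ-perm γ L

    reducedAt-row : ∀ c → reducedAt zero c ≡ c
    reducedAt-row c = begin
      γ (L (inv σ-perm zero) (inv σ-perm c))  ≡⟨ cong (λ v → γ (L v (inv σ-perm c))) inv-zero ⟩
      γ (L u (inv σ-perm c))                  ≡⟨ cong (transpose u zero) (inv-left (proj₁ latin u) _) ⟩
      transpose u zero (inv σ-perm c)         ≡⟨ inv-right σ-perm c ⟩
      c                                       ∎
      where
      open ≡-Reasoning
      inv-zero : inv σ-perm zero ≡ u
      inv-zero = trans (cong (inv σ-perm) (sym (transpose-matchˡ u zero))) (inv-left σ-perm u)

    module _ (symmetric : IsSymmetric L) where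

      reducedAt-symmetric : IsSymmetric reducedAt
      reducedAt-symmetric = isotope-IsSymmetric {L = L} σ-perm γ-perm symmetric

      -- Symmetry survives an isotopism with equal row and column permutations, so the first column
      -- follows from the first row.
      reducedAt-reduced : IsReduced reducedAt
      reducedAt-reduced r c =
        (λ r≡0 → trans (cong (λ v → reducedAt v c) (toℕ-injective r≡0)) (reducedAt-row c)) ,
        (λ c≡0 → trans (reducedAt-symmetric r c)
                   (trans (cong (λ v → reducedAt v r) (toℕ-injective c≡0)) (reducedAt-row r)))

      reducedAt-ReducedSymIsotope : ReducedSymIsotope L reducedAt
      reducedAt-ReducedSymIsotope =
        isotope-IsLatin σ-perm γ-perm latin , reducedAt-symmetric , reducedAt-reduced ,
        transpose u zero , γ , isotope-IsRrsIsotopism σ-perm γ-perm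

      reducedAt-UnitalIsotope : UnitalIsotope L u reducedAt
      reducedAt-UnitalIsotope = record
        { α-perm  = σ-perm
        ; γ-perm  = γ-perm
        ; maps    = proj₂ (proj₂ (isotope-IsRrsIsotopism {L = L} σ-perm γ-perm))
        ; reduced = reducedAt-reduced
        ; αu≡0    = transpose-matchˡ u zero
        }

  module _ {M M′ u u′} (unital : UnitalIsotope L u M) (unital′ : UnitalIsotope L u′ M′) where

    open ≡-Reasoning
    open UnitalIsotope unital
    open UnitalIsotope unital′ using () renaming
      ( α to α′; γ to γ′; α-perm to α′-perm; γ-perm to γ′-perm; maps to maps′
      ; reduced to reduced′; αu≡0 to α′u′≡0; γ∘Lu≗α to γ′∘Lu′≗α′)

    -- The row permutation `g`, read through `α` and `α′`, must also act correctly on symbols. Every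
    -- symbol of `L` occurs in row `u`, and on the rows `u` and `u′` the symbol maps are governed by
    -- `α` and `α′`.
    autotopism⇒Isomorphic : ∀ {g g′} → IsRrsIsotopism L L (g , g′) → g u ≡ u′ → Isomorphic M M′
    autotopism⇒Isomorphic {g} {g′} (g-perm , _ , g-maps) gu≡u′ =
      θ , ∘-IsPerm α′-perm (∘-IsPerm g-perm (inv-IsPerm α-perm)) , θ-maps
      where
      θ : Fin (suc m) → Fin (suc m)
      θ = α′ ∘ g ∘ inv α-perm
      θ-maps : MapsTo θ θ θ M M′
      θ-maps r c = begin
        M′ (α′ (g a)) (α′ (g b))  ≡⟨ maps′ (g a) (g b) ⟩
        γ′ (L (g a) (g b))        ≡⟨ cong γ′ (g-maps a b) ⟩
        -- Moving the symbol to column `d` of row `u` makes `gu≡u′` applicable and lets `γ′∘Lu′≗α′`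
        -- remove `γ′`.
        γ′ (g′ (L a b))           ≡⟨ cong (γ′ ∘ g′) Lud≡Lab ⟨
        γ′ (g′ (L u d))           ≡⟨ cong γ′ (g-maps u d) ⟨
        γ′ (L (g u) (g d))        ≡⟨ cong (λ v → γ′ (L v (g d))) gu≡u′ ⟩
        γ′ (L u′ (g d))           ≡⟨ γ′∘Lu′≗α′ (g d) ⟩
        α′ (g d)                  ≡⟨ cong (α′ ∘ g) (inv-left α-perm d) ⟨
        θ (α d)                   ≡⟨ cong θ Mrc≡αd ⟨
        θ (M r c)                 ∎
        where
        a b d : Fin (suc m)
        a = inv α-perm r
        b = inv α-perm c
        d = inv (proj₁ latin u) (L a b)
        Lud≡Lab : L u d ≡ L a b
        Lud≡Lab = inv-right (proj₁ latin u) (L a b)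
        Mrc≡αd : M r c ≡ α d
        Mrc≡αd = begin
          M r c          ≡⟨ cong₂ M (inv-right α-perm r) (inv-right α-perm c) ⟨
          M (α a) (α b)  ≡⟨ maps a b ⟩
          γ (L a b)      ≡⟨ cong γ Lud≡Lab ⟨
          γ (L u d)      ≡⟨ γ∘Lu≗α d ⟩
          α d            ∎

    -- Go from `L` to `M`, across by `θ`, and back from `M′` to `L`. The composite sends `u` to `u′`
    -- because an isomorphism preserves the identity element `zero`.
    Isomorphic⇒autotopism : IsLatin M′ → Isomorphic M M′ →
      ∃ λ g → ∃ λ g′ → IsRrsIsotopism L L (g , g′) × g u ≡ u′
    Isomorphic⇒autotopism latin′ (θ , θ-perm , θ-maps) =
      g , g′ ,
      ( ∘-IsPerm (inv-IsPerm α′-perm) (∘-IsPerm θ-perm α-perm)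
      , ∘-IsPerm (inv-IsPerm γ′-perm) (∘-IsPerm θ-perm γ-perm)
      , λ r c → γ′-perm _ _ (g-maps r c)) ,
      α′-perm _ _ (begin
        α′ (g u)  ≡⟨ inv-right α′-perm _ ⟩
        θ (α u)   ≡⟨ cong θ αu≡0 ⟩
        θ zero    ≡⟨ θ0≡0 ⟩
        zero      ≡⟨ α′u′≡0 ⟨
        α′ u′     ∎)
      where
      g g′ : Fin (suc m) → Fin (suc m)
      g  = inv α′-perm ∘ θ ∘ α
      g′ = inv γ′-perm ∘ θ ∘ γ
      g-maps : ∀ r c → γ′ (L (g r) (g c)) ≡ γ′ (g′ (L r c))
      g-maps r c = begin
        γ′ (L (g r) (g c))          ≡⟨ maps′ (g r) (g c) ⟨
        M′ (α′ (g r)) (α′ (g c))    ≡⟨ cong₂ M′ (inv-right α′-perm _) (inv-right α′-perm _) ⟩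
        M′ (θ (α r)) (θ (α c))      ≡⟨ θ-maps (α r) (α c) ⟩
        θ (M (α r) (α c))           ≡⟨ cong θ (maps r c) ⟩
        θ (γ (L r c))               ≡⟨ inv-right γ′-perm _ ⟨
        γ′ (g′ (L r c))             ∎
      θ0≡0 : θ zero ≡ zero
      -- `θ zero` is idempotent in `M′`, so in column `θ zero` the rows `θ zero` and `zero` hold the
      -- same symbol; cancel in that column.
      θ0≡0 = proj₂ latin′ (θ zero) _ _ (begin
        M′ (θ zero) (θ zero)  ≡⟨ θ-maps zero zero ⟩
        θ (M zero zero)       ≡⟨ cong θ (proj₁ (reduced zero zero) refl) ⟩
        θ zero                ≡⟨ proj₁ (reduced′ zero (θ zero)) refl ⟨
        M′ zero (θ zero)      ∎)

-- The row action of the autotopism group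

module RowAction {m} {L : Square (suc m)} (latin : IsLatin L) where

  rowPerms : List (Fin (suc m) → Fin (suc m))
  rowPerms = map proj₁ (rrsAutotopisms L)

  ∈-rowPerms⁺ : ∀ {α β} → IsRrsIsotopism L L (α , β) → α ∈ rowPerms
  ∈-rowPerms⁺ aut = Anyₚ.map⁺ (Any.map proj₁ (rrsAutotopisms-complete L aut))

  ∈-rowPerms⁻ : ∀ {α} → α ∈ rowPerms → ∃ λ β → IsRrsIsotopism L L (α , β)
  ∈-rowPerms⁻ α∈ with (_ , β) , p∈ , α≗ ← find (Anyₚ.map⁻ α∈) =
    β , IsRrsAutotopism-resp-≗ L (sym ∘ α≗ , λ _ → refl) (All.lookup (rrsAutotopisms-sound L) p∈)

  -- Every symbol occurs in row `zero`, where `maps` expresses its image through the row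
  -- permutation. Hence projecting autotopisms to row permutations creates no repetitions, and
  -- Burnside's lemma applies to a list as long as that of the autotopisms.
  symbol-perm-unique : ∀ {α α′ β β′} → IsRrsIsotopism L L (α , β) → IsRrsIsotopism L L (α′ , β′) →
                       α ≗ α′ → β ≗ β′
  symbol-perm-unique {α} {α′} {β} {β′} (_ , _ , maps) (_ , _ , maps′) α≗α′ s = begin
    β s                      ≡⟨ cong β Lc≡s ⟨
    β (L zero c)             ≡⟨ maps zero c ⟨
    L (α zero) (α c)         ≡⟨ cong₂ L (α≗α′ zero) (α≗α′ c) ⟩
    L (α′ zero) (α′ c)       ≡⟨ maps′ zero c ⟩
    β′ (L zero c)            ≡⟨ cong β′ Lc≡s ⟩
    β′ s                     ∎
    where
    open ≡-Reasoning
    c : Fin (suc m)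
    c = inv (proj₁ latin zero) s
    Lc≡s : L zero c ≡ s
    Lc≡s = inv-right (proj₁ latin zero) s

  rowPerms-! : Unique (Fin (suc m) →-setoid Fin (suc m)) rowPerms
  rowPerms-! = AllPairsₚ.map⁺ (AllPairs-map-local
    (λ aut aut′ p≢p′ α≗α′ → p≢p′ (α≗α′ , symbol-perm-unique aut aut′ α≗α′))
    (rrsAutotopisms-sound L) (rrsAutotopisms-! L))

  id∈rowPerms : id ∈ rowPerms
  id∈rowPerms = ∈-rowPerms⁺ {β = id} ((λ _ _ → id) , (λ _ _ → id) , λ _ _ → refl)

  ∘∈rowPerms : ∀ {f g} → f ∈ rowPerms → g ∈ rowPerms → (f ∘ g) ∈ rowPerms
  ∘∈rowPerms f∈ g∈ with f′ , f-perm , f′-perm , f-maps ← ∈-rowPerms⁻ f∈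
                   with g′ , g-perm , g′-perm , g-maps ← ∈-rowPerms⁻ g∈ =
    ∈-rowPerms⁺ (∘-IsPerm f-perm g-perm , ∘-IsPerm f′-perm g′-perm ,
      λ r c → trans (f-maps _ _) (cong f′ (g-maps r c)))

  inverse∈rowPerms : ∀ {f} → f ∈ rowPerms → ∃ λ g → g ∈ rowPerms × g ∘ f ≗ id × f ∘ g ≗ id
  inverse∈rowPerms f∈ with f′ , f-perm , f′-perm , f-maps ← ∈-rowPerms⁻ f∈ =
    inv f-perm ,
    ∈-rowPerms⁺ (inv-IsPerm f-perm , inv-IsPerm f′-perm , λ r c → f′-perm _ _
      (trans (sym (f-maps _ _))
        (trans (cong₂ L (inv-right f-perm r) (inv-right f-perm c)) (sym (inv-right f′-perm (L r c)))))) ,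
    inv-left f-perm , inv-right f-perm

  open Burnside rowPerms rowPerms-! id∈rowPerms ∘∈rowPerms inverse∈rowPerms public

  module _ {M M′ u u′} (unital : UnitalIsotope L u M) (unital′ : UnitalIsotope L u′ M′) where

    ~⇒Isomorphic : u ~ u′ → Isomorphic M M′
    ~⇒Isomorphic u~u′ =
      let _ , g∈ , gu≡u′ = ~-elim u~u′
          _ , aut = ∈-rowPerms⁻ g∈
      in autotopism⇒Isomorphic latin unital unital′ aut gu≡u′

    Isomorphic⇒~ : IsLatin M′ → Isomorphic M M′ → u ~ u′
    Isomorphic⇒~ latin′ iso =
      let _ , _ , aut , gu≡u′ = Isomorphic⇒autotopism latin unital unital′ latin′ iso
      in ~-intro (∈-rowPerms⁺ aut) gu≡u′

-- Isomorphism classes as orbits on rows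

theorem6 : (n : ℕ) → 1 ≤ n → (L : Square n) → IsLatin L → IsSymmetric L →
    Σ (List (Square n)) λ reps →
    IsClassRepresentatives (ReducedSymIsotope L) reps
    × (length reps * length (rrsAutotopisms L)
    ≡ sum (map (λ p → λ-fun (proj₁ p) (proj₂ p)) (rrsAutotopisms L)))
theorem6 (suc m) _ L latin symmetric = reps , (reps-sound , reps-distinct , reps-complete) , count
  where
  open RowAction latin

  reps : List (Square (suc m))
  reps = map (reducedAt latin) orbitReps

  unital : ∀ u → UnitalIsotope L u (reducedAt latin u)
  unital u = reducedAt-UnitalIsotope latin u symmetric

  sound : ∀ u → ReducedSymIsotope L (reducedAt latin u)
  sound u = reducedAt-ReducedSymIsotope latin u symmetric

  reps-sound : All (ReducedSymIsotope L) reps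
  reps-sound = Allₚ.map⁺ (All.universal sound orbitReps)

  reps-distinct : AllPairs (λ A B → ¬ Isomorphic A B) reps
  reps-distinct = AllPairsₚ.map⁺ (AllPairs.map
    (λ {u} {v} u≁v iso → u≁v (Isomorphic⇒~ (unital u) (unital v) (proj₁ (sound v)) iso)) orbitReps-!)

  reps-complete : ∀ M → ReducedSymIsotope L M → Any (λ R → Isomorphic M R) reps
  reps-complete M (_ , _ , M-reduced , α , γ , α-perm , γ-perm , maps) =
    Anyₚ.map⁺ (Any.map (λ {v} → ~⇒Isomorphic M-unital (unital v))
      -- The row of `L` that `α` moves to the first place becomes the identity row of `M`, so its
      -- orbit decides the class of `M`.
      (orbitReps-complete (inv α-perm zero)))
    where
    M-unital : UnitalIsotope L (inv α-perm zero) M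
    M-unital = record
      { α-perm  = α-perm
      ; γ-perm  = γ-perm
      ; maps    = maps
      ; reduced = M-reduced
      ; αu≡0    = inv-right α-perm zero
      }

  count : length reps * length (rrsAutotopisms L)
        ≡ sum (map (λ p → λ-fun (proj₁ p) (proj₂ p)) (rrsAutotopisms L))
  count = begin
    length reps * length (rrsAutotopisms L)
      ≡⟨ cong₂ _*_ (length-map (reducedAt latin) orbitReps) (sym (length-map proj₁ (rrsAutotopisms L))) ⟩
    length orbitReps * length rowPerms
      ≡⟨ burnside ⟩
    sum (map fixedPoints (map proj₁ (rrsAutotopisms L)))
      ≡⟨ cong sum (map-∘ (rrsAutotopisms L)) ⟨
    sum (map (fixedPoints ∘ proj₁) (rrsAutotopisms L))
      ≡⟨ cong sum (map-cong-local (All.map (λ-fun≡fixedPoints latin) (rrsAutotopisms-sound L))) ⟨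
    sum (map (λ p → λ-fun (proj₁ p) (proj₂ p)) (rrsAutotopisms L)) ∎
    where open ≡-Reasoning
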